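{- Let $S$ be any set, $m\ge 1$, and $s,s'\in S^m$. Then $s$ and $s'$ are mirrored if and only if $s=s'$ or $s=\mathrm{rev}\,s'$.
   Context: $\mathcal{S}_m$ is the group of bijections of $I_m=\{1,\ldots,m\}$, with $\sigma\circ\tau$ meaning apply $\tau$ first. $\mathscr{T}_m=\{\sigma\in\mathcal{S}_m \mid \exists t\in I_m:\ \sigma(1)>\sigma(2)>\cdots>\sigma(t)=1,\ \sigma(t)<\sigma(t+1)<\cdots<\sigma(m)\}$. A sequence $s\in S^m$ is viewed as a function $s:I_m\to S$, and $\mathcal{S}_m$ acts on $S^m$ on the left by $\sigma s=s\circ\sigma^{ -1}$, i.e. $\sigma(s_1,\ldots,s_m)=(s_{\sigma^{ -1}(1)},\ldots,s_{\sigma^{ -1}(m)})$. For $i\in I_m$, $\tau_i(j)=i+1-j$ for $j\le i$ and $\tau_i(j)=j$ for $j>i$; $\mathrm{rev}\,s:=\tau_m s$ is the reversed sequence. Two sequences $s,s'\in S^m$ are called mirrored if for every $\sigma\in\mathscr{T}_m$ there exists $\sigma'\in\mathscr{T}_m$ with $\sigma s=\sigma' s'$, and for every $\tau'\in\mathscr{T}_m$ there exists $\tau\in\mathscr{T}_m$ with $\tau' s'=\tau s$. -}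

module Defs where

open import Data.Fin.Base using (Fin; toℕ; _<_; _≤_)
open import Data.Fin.Permutation using (Permutation′; _⟨$⟩ʳ_; _⟨$⟩ˡ_; reverse)
open import Data.Nat.Base using (ℕ)
open import Data.Product.Base using (_×_; ∃-syntax)
open import Data.Vec.Functional using (Vector)
open import Function.Base using (_∘_)
open import Level using (Level)
open import Relation.Binary.PropositionalEquality using (_≡_; _≗_)

private
  variable
    a : Level
    S : Set a
    m : ℕ

-- I_m = {1, …, m} is represented by Fin m, so all positions and values are
-- shifted down by one; in particular σ(t) = 1 becomes toℕ (σ ⟨$⟩ʳ t) ≡ 0.
--
-- The chains σ(1) > ⋯ > σ(t) and σ(t) < ⋯ < σ(m) are spelled out for all
-- pairs of positions i < j in the respective range.

𝒯 : Permutation′ m → Set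
𝒯 {m} σ = ∃[ t ]
    (∀ (i j : Fin m) → i < j → j ≤ t → σ ⟨$⟩ʳ j < σ ⟨$⟩ʳ i)
  × toℕ (σ ⟨$⟩ʳ t) ≡ 0
  × (∀ (i j : Fin m) → t ≤ i → i < j → σ ⟨$⟩ʳ i < σ ⟨$⟩ʳ j)

infixr 8 _·_

-- The left action σ s = s ∘ σ⁻¹.
_·_ : Permutation′ m → Vector S m → Vector S m
σ · s = s ∘ (σ ⟨$⟩ˡ_)

-- τ_m : j ↦ m + 1 - j on {1, …, m} is the library's reverse.
rev : Vector S m → Vector S m
rev s = reverse · s

-- Sequences are functions, so they are compared pointwise (_≗_).
Mirrored : {S : Set a} {m : ℕ} → Vector S m → Vector S m → Set a
Mirrored {m = m} s s′ =
    (∀ (σ : Permutation′ m) → 𝒯 σ → ∃[ σ′ ] 𝒯 σ′ × σ · s ≗ σ′ · s′)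
  × (∀ (τ′ : Permutation′ m) → 𝒯 τ′ → ∃[ τ ] 𝒯 τ × τ′ · s′ ≗ τ · s)

{-# OPTIONS --safe #-}

-- Read from its last entry backwards, σ s with σ ∈ 𝒯 is s consumed by removing
-- a first or a last letter at every step; so s and s′ are mirrored iff they
-- have the same such readings. Write s = xᵖ u x^q with x the first letter of s
-- and u neither beginning nor ending in x; up to reversal p ≤ q. The longest
-- initial run of x in a reading has length p + q and is followed by a reading
-- of u; the shortest one, if u ≠ [], has length p. By induction this determines
-- p, q and, up to reversal, u. If p < q and u = y v is replaced by rev u = y v′, the readings
-- beginning with xᵖ y give by induction v x^q = v′ x^q or v x^q = x^q (rev v′).
-- In the second case rev v′ commutes with y x^q, which makes u a palindrome.
module Submission where

open import Defs
open import Data.Bool.Base using (Bool; true; false)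
open import Data.Empty using (⊥-elim)
open import Data.Fin.Base as Fin using (Fin; zero; suc; toℕ; fromℕ; inject₁; opposite; punchIn; punchOut)
open import Data.Fin.Permutation using (Permutation′; _⟨$⟩ʳ_; _⟨$⟩ˡ_; inverseˡ; inverseʳ; insert; insert-punchIn; remove; punchIn-permute′; _∘ₚ_) renaming (id to idₚ; reverse to reverseₚ)
import Data.Fin.Properties as Fin
open import Data.List.Base using (List; []; _∷_; _++_; _∷ʳ_; [_]; map; replicate; reverse; length)
open import Data.List.Properties
open import Data.Nat.Base using (ℕ; zero; suc; _+_; _≤_; _<_; _≥_; z≤n; s≤s)
import Data.Nat.Properties as ℕ
open import Data.Product.Base using (_×_; _,_; proj₁; proj₂; ∃-syntax; ∃₂)
open import Data.Sum.Base using (_⊎_; inj₁; inj₂; [_,_]′)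
import Data.Sum.Properties as Sum
open import Data.Vec.Base using (Vec; []; _∷_)
open import Data.Vec.Functional using (Vector; removeAt; toList)
open import Function.Base using (id; _∘_)
open import Function.Bundles using (_⇔_; mk⇔)
open import Level using (Level)
open import Relation.Binary.Definitions using (DecidableEquality)
open import Relation.Binary.PropositionalEquality using (_≡_; _≢_; _≗_; refl; sym; trans; cong; cong₂; subst; subst₂; module ≡-Reasoning)
open import Relation.Nullary.Decidable using (yes; no)
open import Relation.Nullary.Negation using (contradiction)

private
  variable
    a b : Level
    A B : Set a
    n : ℕ
    x y : A
    s t u v w : List A

-- Reversal and powers of a letter

replicate-∷ʳ : ∀ n (x : A) → replicate n x ∷ʳ x ≡ x ∷ replicate n x
replicate-∷ʳ zero    x = refl
replicate-∷ʳ (suc n) x = cong (x ∷_) (replicate-∷ʳ n x)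

replicate-+ : ∀ m n (x : A) → replicate m x ++ replicate n x ≡ replicate (m + n) x
replicate-+ zero    n x = refl
replicate-+ (suc m) n x = cong (x ∷_) (replicate-+ m n x)

reverse-replicate : ∀ n (x : A) → reverse (replicate n x) ≡ replicate n x
reverse-replicate zero    x = refl
reverse-replicate (suc n) x = begin
  reverse (x ∷ replicate n x)  ≡⟨ unfold-reverse x (replicate n x) ⟩
  reverse (replicate n x) ∷ʳ x ≡⟨ cong (_∷ʳ x) (reverse-replicate n x) ⟩
  replicate n x ∷ʳ x           ≡⟨ replicate-∷ʳ n x ⟩
  x ∷ replicate n x            ∎
  where open ≡-Reasoning

reverse-∷ʳ : ∀ (u : List A) x → reverse (u ∷ʳ x) ≡ x ∷ reverse u
reverse-∷ʳ u x = reverse-++ u [ x ]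

∷≡reverse⇒≡∷ʳ : x ∷ v ≡ reverse u → u ≡ reverse v ∷ʳ x
∷≡reverse⇒≡∷ʳ {x = x} {v = v} {u = u} eq = begin
  u                   ≡⟨ reverse-involutive u ⟨
  reverse (reverse u) ≡⟨ cong reverse eq ⟨
  reverse (x ∷ v)     ≡⟨ unfold-reverse x v ⟩
  reverse v ∷ʳ x      ∎
  where open ≡-Reasoning

-- Words commuting with y xⁿ

∈-replicate : ∀ (r : List A) n → r ++ y ∷ v ≡ replicate n x → y ≡ x
∈-replicate []      (suc n) eq = ∷-injectiveˡ eq
∈-replicate (_ ∷ r) (suc n) eq = ∈-replicate r n (∷-injectiveʳ eq)

-- Levi's lemma for the free monoid.
++-split : ∀ (s t : List A) {u v} → s ++ u ≡ t ++ v →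
           (∃[ e ] t ≡ s ++ e × u ≡ e ++ v) ⊎ (∃[ e ] s ≡ t ++ e × v ≡ e ++ u)
++-split []      t       eq = inj₁ (t , refl , eq)
++-split (x ∷ s) []      eq = inj₂ (x ∷ s , refl , sym eq)
++-split (x ∷ s) (y ∷ t) eq with refl , eq′ ← ∷-injective eq | ++-split s t (∷-injectiveʳ eq)
... | inj₁ (e , p , q) = inj₁ (e , cong (x ∷_) p , q)
... | inj₂ (e , p , q) = inj₂ (e , cong (x ∷_) p , q)

-- If r commutes with y xⁿ then r is a power of y xⁿ, so r y is a palindrome.
commute⇒palindrome : ∀ k n r → length r < k → y ≢ x →
                     r ++ y ∷ replicate n x ≡ y ∷ replicate n x ++ r →
                     y ∷ reverse r ≡ r ∷ʳ y
commute⇒palindrome {y = y} {x = x} (suc k) n r (s≤s r≤k) y≢x eq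
  with ++-split r (y ∷ replicate n x) eq
-- Here r = z e = e z with z = y xⁿ, so the shorter word e commutes with z too; `k` bounds the
-- length for this induction.
... | inj₂ (e , r≡ze , r≡ez) = begin
  y ∷ reverse r                       ≡⟨ cong (λ r → y ∷ reverse r) r≡ez ⟩
  y ∷ reverse (e ++ z)                ≡⟨ cong (y ∷_) (reverse-++ e z) ⟩
  y ∷ reverse z ++ reverse e          ≡⟨ cong (λ l → y ∷ l ++ reverse e) (unfold-reverse y X) ⟩
  y ∷ (reverse X ∷ʳ y) ++ reverse e   ≡⟨ cong (λ l → y ∷ (l ∷ʳ y) ++ reverse e) (reverse-replicate n x) ⟩
  y ∷ (X ∷ʳ y) ++ reverse e           ≡⟨ cong (y ∷_) (++-assoc X [ y ] (reverse e)) ⟩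
  z ++ y ∷ reverse e                  ≡⟨ cong (z ++_) ih ⟩
  z ++ e ∷ʳ y                         ≡⟨ ++-assoc z e [ y ] ⟨
  (z ++ e) ∷ʳ y                       ≡⟨ cong (_∷ʳ y) r≡ze ⟨
  r ∷ʳ y                              ∎
  where
  open ≡-Reasoning
  X = replicate n x
  z = y ∷ X
  |e|<|r| : length e < length r
  |e|<|r| = subst (length e <_) (sym (trans (cong length r≡ze) (cong suc (length-++ X)))) (s≤s (ℕ.m≤n+m _ _))
  ih = commute⇒palindrome k n e (ℕ.≤-trans |e|<|r| r≤k) y≢x (trans (sym r≡ez) r≡ze)
commute⇒palindrome (suc k) n []      _ y≢x eq | inj₁ _ = refl
commute⇒palindrome {y = y} {x = x} (suc k) n (_ ∷ r) _ y≢x eq | inj₁ ([] , z≡re , _)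
  with refl , X≡r[] ← ∷-injective z≡re
  with refl ← trans X≡r[] (++-identityʳ r) = cong (y ∷_) (begin
    reverse (y ∷ replicate n x)  ≡⟨ unfold-reverse y (replicate n x) ⟩
    reverse (replicate n x) ∷ʳ y ≡⟨ cong (_∷ʳ y) (reverse-replicate n x) ⟩
    replicate n x ∷ʳ y           ∎)
  where open ≡-Reasoning
-- If y xⁿ = r e = e r with both factors nonempty, both begin with y, and in r e the second of these
-- letters lies inside xⁿ.
commute⇒palindrome (suc k) n (_ ∷ r) _ y≢x eq | inj₁ (_ ∷ e , z≡re , z≡er)
  with refl , X≡re ← ∷-injective z≡re | refl ← ∷-injectiveˡ z≡er =
  contradiction (∈-replicate r n (sym X≡re)) y≢x

-- Readings of a word from its two ends

-- `right` takes its decomposition as an equation, so that readings of a word of any shape can be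
-- matched on.
data Reads {A : Set a} : List A → List A → Set a where
  done  : Reads [] []
  left  : Reads u w → Reads (x ∷ u) (x ∷ w)
  right : v ≡ u ∷ʳ x → Reads u w → Reads v (x ∷ w)

reads-self : ∀ (s : List A) → Reads s s
reads-self []      = done
reads-self (x ∷ s) = left (reads-self s)

reads-reverse : Reads s w → Reads (reverse s) w
reads-reverse done           = done
reads-reverse (left {u = u} {x = x} r) = right (unfold-reverse x u) (reads-reverse r)
reads-reverse (right {u = u} {x = x} refl r) =
  subst (λ v → Reads v _) (sym (reverse-∷ʳ u x)) (left (reads-reverse r))

infix 4 _≼_ _∼_

_≼_ : List A → List A → Set _
s ≼ t = ∀ {w} → Reads s w → Reads t w

_∼_ : List A → List A → Set _
s ∼ t = s ≡ t ⊎ s ≡ reverse t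

∼-sym : s ∼ t → t ∼ s
∼-sym (inj₁ refl) = inj₁ refl
∼-sym (inj₂ refl) = inj₂ (sym (reverse-involutive _))

∼-trans : s ∼ t → t ∼ u → s ∼ u
∼-trans (inj₁ refl) t∼u         = t∼u
∼-trans (inj₂ refl) (inj₁ refl) = inj₂ refl
∼-trans (inj₂ refl) (inj₂ refl) = inj₁ (reverse-involutive _)

∼⇒≼ : s ∼ t → s ≼ t
∼⇒≼ (inj₁ refl) r = r
∼⇒≼ (inj₂ refl) r = subst (λ v → Reads v _) (reverse-involutive _) (reads-reverse r)

∼⇒length≡ : s ∼ t → length s ≡ length t
∼⇒length≡         (inj₁ refl) = refl
∼⇒length≡ {t = t} (inj₂ refl) = length-reverse t

-- Words of the form xᵖ u x^q

module Padding {A : Set a} (x : A) where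

  pad : ℕ → List A → ℕ → List A
  pad p u q = replicate p x ++ u ++ replicate q x

  Core : List A → Set a
  Core u = (∀ v → u ≢ x ∷ v) × (∀ v → u ≢ v ∷ʳ x)

  reverse-pad : ∀ p u q → reverse (pad p u q) ≡ pad q (reverse u) p
  reverse-pad p u q = begin
    reverse (P ++ u ++ Q)                   ≡⟨ reverse-++ P (u ++ Q) ⟩
    reverse (u ++ Q) ++ reverse P           ≡⟨ cong₂ _++_ (reverse-++ u Q) (reverse-replicate p x) ⟩
    (reverse Q ++ reverse u) ++ P           ≡⟨ cong (λ l → (l ++ reverse u) ++ P) (reverse-replicate q x) ⟩
    (Q ++ reverse u) ++ P                   ≡⟨ ++-assoc Q (reverse u) P ⟩
    Q ++ reverse u ++ P                     ∎
    where
    open ≡-Reasoning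
    P = replicate p x
    Q = replicate q x

  core-reverse : Core u → Core (reverse u)
  core-reverse {u = u} (¬l , ¬r) =
    (λ v eq → ¬r (reverse v) (∷≡reverse⇒≡∷ʳ (sym eq))) ,
    (λ v eq → ¬l (reverse v) (trans (sym (reverse-involutive u)) (trans (cong reverse eq) (reverse-∷ʳ v x))))

  pad-suc : ∀ p u q → pad p u (suc q) ≡ pad p u q ∷ʳ x
  pad-suc p u q = begin
    P ++ u ++ x ∷ Q       ≡⟨ cong (λ l → P ++ u ++ l) (replicate-∷ʳ q x) ⟨
    P ++ u ++ Q ∷ʳ x      ≡⟨ cong (P ++_) (++-assoc u Q [ x ]) ⟨
    P ++ (u ++ Q) ∷ʳ x    ≡⟨ ++-assoc P (u ++ Q) [ x ] ⟨
    (P ++ u ++ Q) ∷ʳ x    ∎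
    where
    open ≡-Reasoning
    P = replicate p x
    Q = replicate q x

  reads-padˡ : ∀ p → Reads v w → Reads (replicate p x ++ v) (replicate p x ++ w)
  reads-padˡ zero    r = r
  reads-padˡ (suc p) r = left (reads-padˡ p r)

  reads-padʳ : ∀ q → Reads v w → Reads (v ++ replicate q x) (replicate q x ++ w)
  reads-padʳ {v = v} zero    r = subst (λ v → Reads v _) (sym (++-identityʳ v)) r
  reads-padʳ {v = v} (suc q) r = right (pad-suc 0 v q) (reads-padʳ q r)

  -- If p = 0 and u is empty, the first x belongs to x^q; the letters of that block being equal, its
  -- removal just lowers q.
  pad≡x∷ : ∀ p u q → Core u → pad p u q ≡ x ∷ v →
           (∃[ p′ ] p ≡ suc p′ × v ≡ pad p′ u q) ⊎ (∃[ q′ ] q ≡ suc q′ × v ≡ pad p u q′)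
  pad≡x∷ (suc p) u       q       core eq = inj₁ (p , refl , sym (∷-injectiveʳ eq))
  pad≡x∷ zero    []      (suc q) core eq = inj₂ (q , refl , sym (∷-injectiveʳ eq))
  pad≡x∷ zero    (y ∷ u) q       core eq = contradiction (cong (_∷ u) (∷-injectiveˡ eq)) (proj₁ core u)

  -- The core offers no x at either end, so the letter comes from a block. A removal on the right is
  -- one on the left of the reversed word, with p and q exchanged.
  reads-pad-x∷ : ∀ p u q → Core u → Reads (pad p u q) (x ∷ w) →
                 (∃[ p′ ] p ≡ suc p′ × Reads (pad p′ u q) w) ⊎ (∃[ q′ ] q ≡ suc q′ × Reads (pad p u q′) w)
  reads-pad-x∷ {w = w} p u q core r = go refl r
    where
    unreverse : ∀ p q → v ≡ pad p (reverse u) q → Reads v w → Reads (pad q u p) w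
    unreverse p q refl r =
      subst (λ v → Reads v w) (trans (reverse-pad p (reverse u) q) (cong (λ u → pad q u p) (reverse-involutive u))) (reads-reverse r)

    go : v ≡ pad p u q → Reads v (x ∷ w) →
         (∃[ p′ ] p ≡ suc p′ × Reads (pad p′ u q) w) ⊎ (∃[ q′ ] q ≡ suc q′ × Reads (pad p u q′) w)
    go eq (left r) with pad≡x∷ p u q core (sym eq)
    ... | inj₁ (p′ , e , refl) = inj₁ (p′ , e , r)
    ... | inj₂ (q′ , e , refl) = inj₂ (q′ , e , r)
    go eq (right {u = v} eq′ r)
      with pad≡x∷ q (reverse u) p (core-reverse core)
             (trans (sym (reverse-pad p u q)) (trans (cong reverse (trans (sym eq) eq′)) (reverse-∷ʳ v x)))
    ... | inj₁ (q′ , e , eq″) = inj₂ (q′ , e , unreverse q′ p eq″ (reads-reverse r))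
    ... | inj₂ (p′ , e , eq″) = inj₁ (p′ , e , unreverse q p′ eq″ (reads-reverse r))

  -- By `reads-pad-x∷`, each x that is read shortens one block and leaves u intact.
  unpad : ∀ k p u q → Core u → Reads (pad p u q) (replicate k x ++ w) →
          ∃₂ λ p′ q′ → p′ ≤ p × q′ ≤ q × p′ + q′ + k ≡ p + q × Reads (pad p′ u q′) w
  unpad zero    p u q core r = p , q , ℕ.≤-refl , ℕ.≤-refl , ℕ.+-identityʳ (p + q) , r
  unpad (suc k) p u q core r with reads-pad-x∷ p u q core r
  ... | inj₁ (p₁ , refl , r₁) with unpad k p₁ u q core r₁
  ...   | p′ , q′ , p′≤ , q′≤ , eq , r′ =
          p′ , q′ , ℕ.m≤n⇒m≤1+n p′≤ , q′≤ , trans (ℕ.+-suc (p′ + q′) k) (cong suc eq) , r′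
  unpad (suc k) p u q core r | inj₂ (q₁ , refl , r₁) with unpad k p u q₁ core r₁
  ...   | p′ , q′ , p′≤ , q′≤ , eq , r′ =
          p′ , q′ , p′≤ , ℕ.m≤n⇒m≤1+n q′≤ ,
          trans (ℕ.+-suc (p′ + q′) k) (trans (cong suc eq) (sym (ℕ.+-suc p q₁))) , r′

  -- A letter other than x is exposed only on a side whose block is used up. For the right side,
  -- later arguments need just this exhaustion.
  reads-pad-y∷ : ∀ p u q → y ≢ x → Reads (pad p u q) (y ∷ w) →
                 (p ≡ 0 × ∃[ v ] u ++ replicate q x ≡ y ∷ v × Reads v w) ⊎ q ≡ 0
  reads-pad-y∷ {y = y} {w = w} p u q y≢x r = go p q refl r
    where
    go : ∀ p q → v ≡ pad p u q → Reads v (y ∷ w) →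
         (p ≡ 0 × ∃[ v ] u ++ replicate q x ≡ y ∷ v × Reads v w) ⊎ q ≡ 0
    go zero    q       eq (left {u = v} r)     = inj₁ (refl , v , sym eq , r)
    go (suc p) q       eq (left r)             = contradiction (∷-injectiveˡ eq) y≢x
    go p       zero    eq (right _ r)          = inj₂ refl
    go p       (suc q) eq (right {u = v} eq′ r) =
      contradiction (∷ʳ-injectiveʳ v (pad p u q) (trans (sym eq′) (trans eq (pad-suc p u q)))) y≢x

  -- Both blocks can be read first, followed by any reading of u. The second word must supply these
  -- p + q letters from its own blocks; if that exhausts them, a reading of u′ remains.
  ≼⇒core : ∀ p u q p′ u′ q′ → Core u′ → pad p u q ≼ pad p′ u′ q′ →
           p + q ≤ p′ + q′ × (p + q ≡ p′ + q′ → u ≼ u′)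
  ≼⇒core p u q p′ u′ q′ core′ sub = size (reads-self u) , λ eq r → inner eq (strip r)
    where
    strip : Reads u w → ∃₂ λ p″ q″ → p″ ≤ p′ × q″ ≤ q′ × p″ + q″ + (p + q) ≡ p′ + q′ × Reads (pad p″ u′ q″) w
    strip {w = w} r = unpad (p + q) p′ u′ q′ core′ (sub
      (subst (Reads (pad p u q)) (trans (sym (++-assoc (replicate p x) _ w)) (cong (_++ w) (replicate-+ p q x)))
        (reads-padˡ p (reads-padʳ q r))))

    size : Reads u w → p + q ≤ p′ + q′
    size r with p″ , q″ , _ , _ , eq , _ ← strip r = subst (p + q ≤_) eq (ℕ.m≤n+m (p + q) (p″ + q″))

    inner : p + q ≡ p′ + q′ →
            (∃₂ λ p″ q″ → p″ ≤ p′ × q″ ≤ q′ × p″ + q″ + (p + q) ≡ p′ + q′ × Reads (pad p″ u′ q″) w) → Reads u′ w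
    inner pq (p″ , q″ , _ , _ , eq , r)
      with sum≡0 ← ℕ.+-cancelʳ-≡ (p + q) (p″ + q″) 0 (trans eq (sym pq))
      with refl ← ℕ.m+n≡0⇒m≡0 p″ sum≡0 | refl ← ℕ.m+n≡0⇒n≡0 p″ sum≡0 =
      subst (λ v → Reads v _) (++-identityʳ u′) r

  -- The first word has a reading starting with xᵖ y. To follow it, the second word must exhaust one
  -- block within p steps, and its shorter block has length p′.
  ≼⇒min≤ : ∀ p y v q p′ u′ q′ → y ≢ x → Core u′ → p′ ≤ q′ →
           pad p (y ∷ v) q ≼ pad p′ u′ q′ → p′ ≤ p
  ≼⇒min≤ p y v q p′ u′ q′ y≢x core′ p′≤q′ sub
    with unpad p p′ u′ q′ core′ (sub (reads-padˡ p (left (reads-self (v ++ replicate q x)))))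
  ... | p″ , q″ , p″≤ , q″≤ , eq , r with reads-pad-y∷ p″ u′ q″ y≢x r
  ...   | inj₁ (refl , _) = ℕ.+-cancelʳ-≤ q′ p′ p (begin
            p′ + q′ ≡⟨ eq ⟨
            q″ + p  ≡⟨ ℕ.+-comm q″ p ⟩
            p + q″  ≤⟨ ℕ.+-monoʳ-≤ p q″≤ ⟩
            p + q′  ∎)
          where open ℕ.≤-Reasoning
  ...   | inj₂ refl = ℕ.≤-trans p′≤q′ (ℕ.+-cancelˡ-≤ p′ q′ p (begin
            p′ + q′     ≡⟨ eq ⟨
            p″ + 0 + p  ≡⟨ cong (_+ p) (ℕ.+-identityʳ p″) ⟩
            p″ + p      ≤⟨ ℕ.+-monoˡ-≤ p p″≤ ⟩
            p′ + p      ∎))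
          where open ℕ.≤-Reasoning

  -- After xᵖ, the second word can release y only at the left of its core: exposing the right end
  -- takes q > p letters x. Hence x^q is still whole.
  ≼⇒tail : ∀ p y v q y′ v′ → y ≢ x → Core (y′ ∷ v′) → p < q →
           pad p (y ∷ v) q ≼ pad p (y′ ∷ v′) q → y ≡ y′ × v ++ replicate q x ≼ v′ ++ replicate q x
  ≼⇒tail p y v q y′ v′ y≢x core′ p<q sub =
    proj₁ (tail (reads-self _)) , λ r → proj₂ (tail r)
    where
    tail : Reads (v ++ replicate q x) w → y ≡ y′ × Reads (v′ ++ replicate q x) w
    tail r with unpad p p (y′ ∷ v′) q core′ (sub (reads-padˡ p (left r)))
    ... | p″ , q″ , p″≤ , q″≤ , eq , r′ with reads-pad-y∷ p″ (y′ ∷ v′) q″ y≢x r′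
    ...   | inj₁ (refl , _ , refl , r″)
            with refl ← ℕ.+-cancelʳ-≡ p q″ q (trans eq (ℕ.+-comm p q)) = refl , r″
    ...   | inj₂ refl = contradiction p<q (ℕ.≤⇒≯ (ℕ.≤-trans (ℕ.≤-reflexive (sym p″≡q)) p″≤))
      where
      p″≡q : p″ ≡ q
      p″≡q = ℕ.+-cancelʳ-≡ p p″ q (trans (cong (_+ p) (sym (ℕ.+-identityʳ p″))) (trans eq (ℕ.+-comm p q)))

  -- In the reversed case put r = rev v′. Then y v = r y and v x^q = x^q r, so r y x^q = y v x^q = y
  -- x^q r, and `commute⇒palindrome` gives r y = y v′.
  tails-∼⇒≡ : ∀ y v v′ q → y ≢ x → y ∷ v ≡ reverse (y ∷ v′) →
              v ++ replicate q x ∼ v′ ++ replicate q x → v ≡ v′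
  tails-∼⇒≡ y v v′ q y≢x u≡rev (inj₁ eq) = ++-cancelʳ _ v v′ eq
  tails-∼⇒≡ y v v′ q y≢x u≡rev (inj₂ eq) = ∷-injectiveʳ (begin
    y ∷ v            ≡⟨ u≡ry ⟩
    r ∷ʳ y           ≡⟨ commute⇒palindrome _ q r ℕ.≤-refl y≢x commute ⟨
    y ∷ reverse r    ≡⟨ cong (y ∷_) (reverse-involutive v′) ⟩
    y ∷ v′           ∎)
    where
    open ≡-Reasoning
    r = reverse v′
    Q = replicate q x

    u≡ry : y ∷ v ≡ r ∷ʳ y
    u≡ry = trans u≡rev (unfold-reverse y v′)

    commute : r ++ y ∷ Q ≡ y ∷ Q ++ r
    commute = begin
      r ++ y ∷ Q                   ≡⟨ ++-assoc r [ y ] Q ⟨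
      (r ∷ʳ y) ++ Q                ≡⟨ cong (_++ Q) u≡ry ⟨
      y ∷ v ++ Q                   ≡⟨ cong (y ∷_) eq ⟩
      y ∷ reverse (v′ ++ Q)        ≡⟨ cong (y ∷_) (reverse-++ v′ Q) ⟩
      y ∷ reverse Q ++ r           ≡⟨ cong (λ l → y ∷ l ++ r) (reverse-replicate q x) ⟩
      y ∷ Q ++ r                   ∎

  -- The induction step, with `ih` the hypothesis for shorter words; `0 < q` makes the core shorter
  -- than the whole word.
  pad-∼ : ∀ p u q p′ u′ q′ → Core u → Core u′ → p ≤ q → p′ ≤ q′ → 0 < q →
          (∀ {s t : List A} → length s < length (pad p u q) → s ≼ t → t ≼ s → s ∼ t) →
          pad p u q ≼ pad p′ u′ q′ → pad p′ u′ q′ ≼ pad p u q → pad p u q ∼ pad p′ u′ q′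
  pad-∼ p u q p′ u′ q′ core core′ p≤q p′≤q′ 0<q ih s≼t t≼s = go u u′ core core′ ih s≼t t≼s u∼u′
    where
    size : p + q ≡ p′ + q′
    size = ℕ.≤-antisym (proj₁ (≼⇒core p u q p′ u′ q′ core′ s≼t)) (proj₁ (≼⇒core p′ u′ q′ p u q core t≼s))

    |u|<|s| : length u < length (pad p u q)
    |u|<|s| = begin-strict
      length u                                        ≡⟨ ℕ.+-identityʳ _ ⟨
      length u + 0                                    <⟨ ℕ.+-monoʳ-< (length u) 0<q ⟩
      length u + q                                    ≡⟨ cong (length u +_) (length-replicate q) ⟨
      length u + length (replicate q x)               ≡⟨ length-++ u ⟨
      length (u ++ replicate q x)                     ≤⟨ ℕ.m≤n+m _ _ ⟩
      length (replicate p x) + length (u ++ replicate q x) ≡⟨ length-++ (replicate p x) ⟨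
      length (pad p u q)                              ∎
      where open ℕ.≤-Reasoning

    u∼u′ : u ∼ u′
    u∼u′ = ih |u|<|s| (proj₂ (≼⇒core p u q p′ u′ q′ core′ s≼t) size)
                      (proj₂ (≼⇒core p′ u′ q′ p u q core t≼s) (sym size))

    go : ∀ u u′ → Core u → Core u′ →
         (∀ {s t : List A} → length s < length (pad p u q) → s ≼ t → t ≼ s → s ∼ t) →
         pad p u q ≼ pad p′ u′ q′ → pad p′ u′ q′ ≼ pad p u q → u ∼ u′ → pad p u q ∼ pad p′ u′ q′
    -- Both words are powers of x, so only the total exponent matters; p and p′ may differ.
    go []      []        _ _ _ _ _ _ =
      inj₁ (trans (replicate-+ p q x) (trans (cong (λ k → replicate k x) size) (sym (replicate-+ p′ q′ x))))
    go []      (y′ ∷ v′) _ _ _ _ _ e with () ← ∼⇒length≡ e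
    go (y ∷ v) []        _ _ _ _ _ e with () ← ∼⇒length≡ e
    go (y ∷ v) (y′ ∷ v′) core core′ ih s≼t t≼s e
      with refl ← ℕ.≤-antisym (≼⇒min≤ p′ y′ v′ q′ p (y ∷ v) q (λ { refl → proj₁ core′ v′ refl }) core p≤q t≼s)
                              (≼⇒min≤ p y v q p′ (y′ ∷ v′) q′ (λ { refl → proj₁ core v refl }) core′ p′≤q′ s≼t)
      with refl ← ℕ.+-cancelˡ-≡ p q q′ size
      with e | ℕ.m≤n⇒m<n∨m≡n p≤q
    ... | inj₁ refl | _ = inj₁ refl
    -- With equal blocks, reversing the core reverses the whole word.
    ... | inj₂ u≡rev | inj₂ refl =
          inj₂ (trans (cong (λ u → pad p u p) u≡rev) (sym (reverse-pad p (y′ ∷ v′) p)))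
    -- With unequal blocks, `ih` is used again, on the tails v x^q and v′ x^q.
    ... | inj₂ u≡rev | inj₁ p<q
          with refl , v≼v′ ← ≼⇒tail p y v q y′ v′ (λ { refl → proj₁ core v refl }) core′ p<q s≼t
          with _    , v′≼v ← ≼⇒tail p y′ v′ q y v (λ { refl → proj₁ core′ v′ refl }) core p<q t≼s
          = inj₁ (cong (λ v → pad p (y ∷ v) q)
                   (tails-∼⇒≡ y v v′ q (λ { refl → proj₁ core v refl }) u≡rev (ih |vx|<|s| v≼v′ v′≼v)))
      where
      |vx|<|s| : length (v ++ replicate q x) < length (pad p (y ∷ v) q)
      |vx|<|s| = ℕ.≤-trans (ℕ.m≤n+m _ _) (ℕ.≤-reflexive (sym (length-++ (replicate p x))))

  -- Decomposing only up to reversal is what permits `low ≤ high`.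
  record Padded (s : List A) : Set a where
    constructor padded
    field
      low high  : ℕ
      inner     : List A
      low≤high  : low ≤ high
      core      : Core inner
      s∼pad     : s ∼ pad low inner high

  pad-padded : ∀ p u q → Core u → Padded (pad p u q)
  pad-padded p u q core with ℕ.≤-total p q
  ... | inj₁ p≤q = padded p q u p≤q core (inj₁ refl)
  ... | inj₂ q≤p = padded q p (reverse u) q≤p (core-reverse core)
                     (∼-sym (inj₂ (sym (reverse-pad p u q))))

  module _ (_≟_ : DecidableEquality A) where

    strip : ∀ s → ∃₂ λ p t → s ≡ replicate p x ++ t × (∀ v → t ≢ x ∷ v)
    strip []      = 0 , [] , refl , λ _ ()
    strip (y ∷ s) with y ≟ x
    ... | no  y≢x = 0 , y ∷ s , refl , λ _ eq → y≢x (∷-injectiveˡ eq)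
    ... | yes refl with p , t , eq , ¬x ← strip s = suc p , t , cong (x ∷_) eq , ¬x

    decompose : ∀ s → Padded s
    decompose s
      with p , t , refl , ¬x  ← strip s
      -- The final run of x is found as the initial run of the reversal.
      with q , u , eq , ¬x′ ← strip (reverse t) =
      subst Padded (cong (replicate p x ++_) (sym t≡)) (pad-padded p (reverse u) q
        ( (λ v e → ¬x (v ++ replicate q x) (trans t≡ (cong (_++ replicate q x) e)))
        , (λ v e → ¬x′ (reverse v) (trans (sym (reverse-involutive u)) (trans (cong reverse e) (reverse-∷ʳ v x))))))
      where
      open ≡-Reasoning
      t≡ : t ≡ reverse u ++ replicate q x
      t≡ = begin
        t                                       ≡⟨ reverse-involutive t ⟨
        reverse (reverse t)                     ≡⟨ cong reverse eq ⟩
        reverse (replicate q x ++ u)            ≡⟨ reverse-++ (replicate q x) u ⟩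
        reverse u ++ reverse (replicate q x)    ≡⟨ cong (reverse u ++_) (reverse-replicate q x) ⟩
        reverse u ++ replicate q x              ∎

-- Strong induction on the length, bounded by `n`. Padding with the first letter of s gives s a
-- nonempty block, so `pad-∼` reaches shorter words.
sameReadings⇒∼ : DecidableEquality A → ∀ n {s t : List A} → length s < n → s ≼ t → t ≼ s → s ∼ t
sameReadings⇒∼ _≟_ (suc n) {[]} _ s≼t _ with done ← s≼t done = inj₁ refl
sameReadings⇒∼ _≟_ (suc n) {x ∷ s} {t} (s≤s s≤n) s≼t t≼s
  with Padding.padded p q u p≤q core s∼ ← Padding.decompose x _≟_ (x ∷ s)
     | Padding.padded p′ q′ u′ p′≤q′ core′ t∼ ← Padding.decompose x _≟_ t =
  ∼-trans s∼ (∼-trans (pad-∼ p u q p′ u′ q′ core core′ p≤q p′≤q′ (0<q p q p≤q s∼)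
    (λ l → sameReadings⇒∼ _≟_ n (ℕ.≤-trans l (ℕ.≤-trans (ℕ.≤-reflexive (sym (∼⇒length≡ s∼))) s≤n)))
    (λ r → ∼⇒≼ t∼ (s≼t (∼⇒≼ (∼-sym s∼) r)))
    (λ r → ∼⇒≼ s∼ (t≼s (∼⇒≼ (∼-sym t∼) r))))
    (∼-sym t∼))
  where
  open Padding x
  0<q : ∀ p q → p ≤ q → x ∷ s ∼ pad p u q → 0 < q
  0<q p    (suc q) _   _         = s≤s z≤n
  -- Without blocks the core would be x s or its reversal, and so begin or end in x.
  0<q zero zero    z≤n (inj₁ eq) = contradiction (trans (sym (++-identityʳ u)) (sym eq)) (proj₁ core s)
  0<q zero zero    z≤n (inj₂ eq) =
    contradiction (∷≡reverse⇒≡∷ʳ (trans eq (cong reverse (++-identityʳ u)))) (proj₂ core (reverse s))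

-- Readings of vectors prescribed by choices of ends

end : Bool → Fin (suc n)
end         false = zero
end {n = n} true  = fromℕ n

-- The choices do not depend on the entries, so the same ones apply to letters and to positions; for
-- fixed length they are finite in number.
read : Vec Bool n → Vector A n → List A
read []      s = []
read (b ∷ c) s = s (end b) ∷ read c (removeAt s (end b))

map-read : ∀ (f : A → B) (c : Vec Bool n) (s : Vector A n) → map f (read c s) ≡ read c (f ∘ s)
map-read f []      s = refl
map-read f (b ∷ c) s = cong (f (s (end b)) ∷_) (map-read f c (removeAt s (end b)))

toList-last : ∀ (s : Vector A (suc n)) → toList s ≡ toList (removeAt s (fromℕ n)) ∷ʳ s (fromℕ n)
toList-last {n = zero}  s = refl
toList-last {n = suc n} s = cong (s zero ∷_) (toList-last (s ∘ suc))

toList-injective : ∀ {s t : Vector A n} → toList s ≡ toList t → s ≗ t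
toList-injective eq zero    = ∷-injectiveˡ eq
toList-injective eq (suc i) = toList-injective (∷-injectiveʳ eq) i

punchIn-fromℕ : ∀ (i : Fin n) → punchIn (fromℕ n) i ≡ inject₁ i
punchIn-fromℕ zero    = refl
punchIn-fromℕ (suc i) = cong suc (punchIn-fromℕ i)

toList-rev : ∀ (s : Vector A n) → toList (rev s) ≡ reverse (toList s)
toList-rev {n = zero}  s = refl
toList-rev {n = suc n} s = begin
  s (fromℕ n) ∷ toList (s ∘ inject₁ ∘ opposite)       ≡⟨ cong (s (fromℕ n) ∷_) (tabulate-cong (cong s ∘ punchIn-fromℕ ∘ opposite)) ⟨
  s (fromℕ n) ∷ toList (rev (removeAt s (fromℕ n)))       ≡⟨ cong (s (fromℕ n) ∷_) (toList-rev (removeAt s (fromℕ n))) ⟩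
  s (fromℕ n) ∷ reverse (toList (removeAt s (fromℕ n)))   ≡⟨ reverse-∷ʳ (toList (removeAt s (fromℕ n))) (s (fromℕ n)) ⟨
  reverse (toList (removeAt s (fromℕ n)) ∷ʳ s (fromℕ n))  ≡⟨ cong reverse (toList-last s) ⟨
  reverse (toList s)                                      ∎
  where open ≡-Reasoning

read⇒Reads : ∀ (c : Vec Bool n) (s : Vector A n) → Reads (toList s) (read c s)
read⇒Reads []          s = done
read⇒Reads (false ∷ c) s = left (read⇒Reads c (s ∘ suc))
read⇒Reads (true  ∷ c) s = right (toList-last s) (read⇒Reads c (removeAt s (fromℕ _)))

Reads⇒read : ∀ (s : Vector A n) → v ≡ toList s → Reads v w → ∃[ c ] w ≡ read c s
Reads⇒read {n = zero} s eq done = [] , refl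
Reads⇒read {n = zero} s eq (right {u = []} refl r) with () ← eq
Reads⇒read {n = zero} s eq (right {u = _ ∷ _} refl r) with () ← eq
Reads⇒read {n = suc n} s eq (left r)
  with refl , eq′ ← ∷-injective eq
  with c , refl ← Reads⇒read (s ∘ suc) eq′ r = false ∷ c , refl
Reads⇒read {n = suc n} s eq (right {u = u} eq′ r)
  with u≡ , refl ← ∷ʳ-injective u (toList (removeAt s (fromℕ n))) (trans (sym eq′) (trans eq (toList-last s)))
  with c , refl ← Reads⇒read (removeAt s (fromℕ n)) u≡ r = true ∷ c , refl

-- Permutations in 𝒯 and choices of ends

-- Avoidance of the patterns 132 and 231. No turning point is named, so the condition passes easily
-- to reversals and to the removal of the largest value.
VShaped : Permutation′ n → Set
VShaped σ = ∀ i j k → i Fin.< j → j Fin.< k → σ ⟨$⟩ʳ j Fin.< σ ⟨$⟩ʳ i ⊎ σ ⟨$⟩ʳ j Fin.< σ ⟨$⟩ʳ k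

𝒯⇒VShaped : ∀ (σ : Permutation′ n) → 𝒯 σ → VShaped σ
𝒯⇒VShaped σ (t , dec , _ , inc) i j k i<j j<k with ℕ.≤-total (toℕ j) (toℕ t)
... | inj₁ j≤t = inj₁ (dec i j i<j j≤t)
... | inj₂ t≤j = inj₂ (inc j k t≤j j<k)

-- The turning point is the position of the least value; used as one outer position, it leaves only
-- one alternative of `VShaped`.
VShaped⇒𝒯 : ∀ (σ : Permutation′ (suc n)) → VShaped σ → 𝒯 σ
VShaped⇒𝒯 σ V = base , dec , cong toℕ σt≡0 , inc
  where
  base = σ ⟨$⟩ˡ zero
  σt≡0 : σ ⟨$⟩ʳ base ≡ zero
  σt≡0 = inverseʳ σ

  ≮σt : ∀ {k} → k Fin.≮ σ ⟨$⟩ʳ base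
  ≮σt k<σt with () ← subst (_ Fin.<_) σt≡0 k<σt

  σt< : ∀ {i} → i ≢ base → σ ⟨$⟩ʳ base Fin.< σ ⟨$⟩ʳ i
  σt< {i} i≢t = ℕ.≰⇒> λ σi≤σt → i≢t (begin
    i                   ≡⟨ inverseˡ σ ⟨
    σ ⟨$⟩ˡ (σ ⟨$⟩ʳ i)  ≡⟨ cong (σ ⟨$⟩ˡ_) (Fin.toℕ-injective (ℕ.n≤0⇒n≡0 (subst (σ ⟨$⟩ʳ i Fin.≤_) σt≡0 σi≤σt))) ⟩
    σ ⟨$⟩ˡ zero         ∎)
    where open ≡-Reasoning

  dec : ∀ i j → i Fin.< j → j Fin.≤ base → σ ⟨$⟩ʳ j Fin.< σ ⟨$⟩ʳ i
  dec i j i<j j≤t with ℕ.m≤n⇒m<n∨m≡n j≤t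
  ... | inj₁ j<t = [ id , ⊥-elim ∘ ≮σt ]′ (V i j base i<j j<t)
  ... | inj₂ j≡t with refl ← Fin.toℕ-injective j≡t = σt< (Fin.<⇒≢ i<j)

  inc : ∀ i j → base Fin.≤ i → i Fin.< j → σ ⟨$⟩ʳ i Fin.< σ ⟨$⟩ʳ j
  inc i j t≤i i<j with ℕ.m≤n⇒m<n∨m≡n t≤i
  ... | inj₁ t<i = [ ⊥-elim ∘ ≮σt , id ]′ (V base i j t<i i<j)
  ... | inj₂ t≡i with refl ← Fin.toℕ-injective t≡i = σt< (Fin.<⇒≢ i<j ∘ sym)

opposite-< : ∀ {i j : Fin n} → i Fin.< j → opposite j Fin.< opposite i
opposite-< {n} {i} {j} i<j =
  subst₂ _<_ (sym (Fin.opposite-prop j)) (sym (Fin.opposite-prop i)) (ℕ.∸-monoʳ-< (s≤s i<j) (Fin.toℕ<n j))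

-- `∘ₚ` applies its left argument first, so positions are reversed and the two alternatives swap.
VShaped-reverse : ∀ (σ : Permutation′ n) → VShaped σ → VShaped (reverseₚ ∘ₚ σ)
VShaped-reverse σ V i j k i<j j<k =
  [ inj₂ , inj₁ ]′ (V _ _ _ (opposite-< j<k) (opposite-< i<j))

-- Adding and removing the largest value

punchIn-mono-< : ∀ p {i j : Fin n} → i Fin.< j → punchIn p i Fin.< punchIn p j
punchIn-mono-< p i<j = ℕ.≰⇒> (ℕ.<⇒≱ i<j ∘ Fin.punchIn-cancel-≤ p _ _)

punchIn-cancel-< : ∀ p {i j : Fin n} → punchIn p i Fin.< punchIn p j → i Fin.< j
punchIn-cancel-< p pi<pj = ℕ.≰⇒> (ℕ.<⇒≱ pi<pj ∘ Fin.punchIn-mono-≤ p _ _)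

punchIn-fromℕ-< : ∀ (i : Fin n) → punchIn (fromℕ n) i Fin.< fromℕ n
punchIn-fromℕ-< i = Fin.≤∧≢⇒< (Fin.≤fromℕ _) (Fin.punchInᵢ≢i (fromℕ _) i)

punchIn-view : ∀ (p i : Fin (suc n)) → i ≡ p ⊎ ∃[ i′ ] i ≡ punchIn p i′
punchIn-view p i with p Fin.≟ i
... | yes p≡i = inj₁ (sym p≡i)
... | no  p≢i = inj₂ (punchOut p≢i , sym (Fin.punchIn-punchOut p≢i))

-- A relation, because such pairs arise both by inserting into τ and by removing from σ.
record ExtendsByMax (p : Fin (suc n)) (τ : Permutation′ n) (σ : Permutation′ (suc n)) : Set where
  field
    at-max  : σ ⟨$⟩ʳ p ≡ fromℕ n
    at-rest : ∀ k → σ ⟨$⟩ʳ punchIn p k ≡ punchIn (fromℕ n) (τ ⟨$⟩ʳ k)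

  from-max : σ ⟨$⟩ˡ fromℕ n ≡ p
  from-max = trans (cong (σ ⟨$⟩ˡ_) (sym at-max)) (inverseˡ σ)

  from-rest : ∀ k → σ ⟨$⟩ˡ punchIn (fromℕ n) k ≡ punchIn p (τ ⟨$⟩ˡ k)
  from-rest k = begin
    σ ⟨$⟩ˡ punchIn (fromℕ n) k                          ≡⟨ cong (λ k → σ ⟨$⟩ˡ punchIn (fromℕ n) k) (inverseʳ τ) ⟨
    σ ⟨$⟩ˡ punchIn (fromℕ n) (τ ⟨$⟩ʳ (τ ⟨$⟩ˡ k))       ≡⟨ cong (σ ⟨$⟩ˡ_) (at-rest (τ ⟨$⟩ˡ k)) ⟨
    σ ⟨$⟩ˡ (σ ⟨$⟩ʳ punchIn p (τ ⟨$⟩ˡ k))               ≡⟨ inverseˡ σ ⟩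
    punchIn p (τ ⟨$⟩ˡ k)                                ∎
    where open ≡-Reasoning

  VShaped-restrict : VShaped σ → VShaped τ
  VShaped-restrict V i j k i<j j<k
    with V (punchIn p i) (punchIn p j) (punchIn p k) (punchIn-mono-< p i<j) (punchIn-mono-< p j<k)
  ... | inj₁ lt = inj₁ (punchIn-cancel-< (fromℕ n) (subst₂ Fin._<_ (at-rest j) (at-rest i) lt))
  ... | inj₂ lt = inj₂ (punchIn-cancel-< (fromℕ n) (subst₂ Fin._<_ (at-rest j) (at-rest k) lt))

  -- The largest value is never the middle one of three, and as an outer one it satisfies its
  -- alternative.
  VShaped-extend : (∀ i k → i Fin.< p → p Fin.≮ k) → VShaped τ → VShaped σ
  VShaped-extend extremal V i j k i<j j<k with punchIn-view p j
  ... | inj₁ refl = contradiction j<k (extremal i k i<j)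
  ... | inj₂ (j′ , refl) with punchIn-view p i | punchIn-view p k
  ...   | inj₁ refl | _ = inj₁ (subst₂ Fin._<_ (sym (at-rest j′)) (sym at-max) (punchIn-fromℕ-< _))
  ...   | _ | inj₁ refl = inj₂ (subst₂ Fin._<_ (sym (at-rest j′)) (sym at-max) (punchIn-fromℕ-< _))
  ...   | inj₂ (i′ , refl) | inj₂ (k′ , refl)
          with V i′ j′ k′ (punchIn-cancel-< p i<j) (punchIn-cancel-< p j<k)
  ...     | inj₁ lt = inj₁ (subst₂ Fin._<_ (sym (at-rest j′)) (sym (at-rest i′)) (punchIn-mono-< (fromℕ n) lt))
  ...     | inj₂ lt = inj₂ (subst₂ Fin._<_ (sym (at-rest j′)) (sym (at-rest k′)) (punchIn-mono-< (fromℕ n) lt))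

end-extremal : ∀ b (i k : Fin (suc n)) → i Fin.< end {n} b → end {n} b Fin.≮ k
end-extremal true i k _ last<k = ℕ.<⇒≱ last<k (Fin.≤fromℕ k)

insert-max : ∀ p (τ : Permutation′ n) → ExtendsByMax p τ (insert p (fromℕ n) τ)
insert-max {n} p τ = record { at-max = at-max ; at-rest = insert-punchIn p (fromℕ n) τ }
  where
  at-max : insert p (fromℕ n) τ ⟨$⟩ʳ p ≡ fromℕ n
  at-max with p Fin.≟ p
  ... | yes _  = refl
  ... | no p≢p = contradiction refl p≢p

remove-max : ∀ (σ : Permutation′ (suc n)) → ExtendsByMax (σ ⟨$⟩ˡ fromℕ n) (remove (σ ⟨$⟩ˡ fromℕ n) σ) σ
remove-max σ = record { at-max = inverseʳ σ ; at-rest = punchIn-permute′ σ (fromℕ _) }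

-- In the interior, the largest value would have to lie below the value at the first or the last
-- position.
max-at-end : ∀ (σ : Permutation′ (suc n)) → VShaped σ → ∃[ b ] σ ⟨$⟩ˡ fromℕ n ≡ end b
max-at-end {n} σ V with Fin.zero Fin.≟ p | p Fin.≟ fromℕ n
  where p = σ ⟨$⟩ˡ fromℕ n
... | yes 0≡p | _         = false , sym 0≡p
... | no _    | yes p≡max = true , p≡max
... | no 0≢p  | no p≢max
    with V zero (σ ⟨$⟩ˡ fromℕ n) (fromℕ n) (Fin.≤∧≢⇒< z≤n 0≢p) (Fin.≤∧≢⇒< (Fin.≤fromℕ _) p≢max)
...   | inj₁ lt = contradiction (Fin.≤fromℕ _) (ℕ.<⇒≱ (subst (Fin._< σ ⟨$⟩ʳ zero) (inverseʳ σ) lt))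
...   | inj₂ lt = contradiction (Fin.≤fromℕ _) (ℕ.<⇒≱ (subst (Fin._< σ ⟨$⟩ʳ fromℕ n) (inverseʳ σ) lt))

-- This is the reversed `toList`, built by deleting the last entry so as to unfold along
-- `ExtendsByMax`.
descending : Vector A n → List A
descending {n = zero}  s = []
descending {n = suc n} s = s (fromℕ n) ∷ descending (removeAt s (fromℕ n))

descending-cong : ∀ {s t : Vector A n} → s ≗ t → descending s ≡ descending t
descending-cong {n = zero}  eq = refl
descending-cong {n = suc n} eq = cong₂ _∷_ (eq (fromℕ n)) (descending-cong (eq ∘ punchIn (fromℕ n)))

descending-extend : ∀ {p τ σ} → ExtendsByMax p τ σ → (s : Vector A (suc n)) →
                    descending (σ · s) ≡ s p ∷ descending (τ · removeAt s p)
descending-extend ext s = cong₂ _∷_ (cong s from-max) (descending-cong (cong s ∘ from-rest))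
  where open ExtendsByMax ext

-- The last entry of σ s is the entry of s where σ is largest, hence an end of s; deleting it leaves
-- a V-shaped permutation.
VShaped⇒read : ∀ (A : Set a) (σ : Permutation′ n) → VShaped σ →
               ∃[ c ] ∀ (s : Vector A n) → descending (σ · s) ≡ read c s
VShaped⇒read {n = zero}  A σ V = [] , λ s → refl
VShaped⇒read {n = suc n} A σ V
  with b , p≡end ← max-at-end σ V
  with τ ← remove (σ ⟨$⟩ˡ fromℕ n) σ | ext ← subst (λ p → ExtendsByMax p (remove (σ ⟨$⟩ˡ fromℕ n) σ) σ) p≡end (remove-max σ)
  with c , eq ← VShaped⇒read A τ (ExtendsByMax.VShaped-restrict ext V) =
  b ∷ c , λ s → trans (descending-extend ext s) (cong (s (end b) ∷_) (eq (removeAt s (end b))))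

-- Each choice places the largest remaining value at the chosen end.
read⇒VShaped : ∀ (A : Set a) (c : Vec Bool n) →
               ∃[ σ ] VShaped σ × (∀ (s : Vector A n) → descending (σ · s) ≡ read c s)
read⇒VShaped A []      = idₚ , (λ ()) , λ s → refl
read⇒VShaped A (b ∷ c) with τ , V , eq ← read⇒VShaped A c =
  insert (end b) (fromℕ _) τ ,
  ExtendsByMax.VShaped-extend ext (end-extremal b) V ,
  λ s → trans (descending-extend ext s) (cong (s (end b) ∷_) (eq (removeAt s (end b))))
  where ext = insert-max (end b) τ

-- S need not have decidable equality, so the finitely many equations
-- map g s ≡ map g t between readings are first solved by some f with g ∘ f ≗ g
-- on the decidable alphabet A of positions.

module _ {A : Set a} (_≟_ : DecidableEquality A) {B : Set b} (g : A → B) where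

  merge : A → A → A → A
  merge x y z with z ≟ x
  ... | yes _ = y
  ... | no  _ = z

  merge-preserves : g x ≡ g y → g ∘ merge x y ≗ g
  merge-preserves {x} gx≡gy z with z ≟ x
  ... | yes refl = sym gx≡gy
  ... | no  _    = refl

  merge-identifies : ∀ x y → merge x y x ≡ merge x y y
  merge-identifies x y with x ≟ x | y ≟ x
  ... | yes _  | yes _ = refl
  ... | yes _  | no  _ = refl
  ... | no x≢x | _     = contradiction refl x≢x

  -- Unification letter by letter: the images of the heads are merged after the tails are solved,
  -- and composing with the merge keeps the earlier equations.
  identify : ∀ s t → map g s ≡ map g t → ∃[ f ] g ∘ f ≗ g × map f s ≡ map f t
  identify []      []      eq = id , (λ _ → refl) , refl
  identify (x ∷ s) (y ∷ t) eq
    with f , gf≗g , fs≡ft ← identify s t (∷-injectiveʳ eq) =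
    h ∘ f ,
    (λ z → trans (merge-preserves gfx≡gfy (f z)) (gf≗g z)) ,
    cong₂ _∷_ (merge-identifies (f x) (f y)) (trans (map-∘ s) (trans (cong (map h) fs≡ft) (sym (map-∘ t))))
    where
    h = merge (f x) (f y)
    gfx≡gfy : g (f x) ≡ g (f y)
    gfx≡gfy = trans (gf≗g x) (trans (∷-injectiveˡ eq) (sym (gf≗g y)))

  identify-all : ∀ n (s t : Vec Bool n → List A) → (∀ c → map g (s c) ≡ map g (t c)) →
                 ∃[ f ] g ∘ f ≗ g × (∀ c → map f (s c) ≡ map f (t c))
  identify-all zero s t eq with f , gf≗g , fs≡ft ← identify (s []) (t []) (eq []) =
    f , gf≗g , λ { [] → fs≡ft }
  identify-all (suc n) s t eq
    with f , gf≗g , fs≡ft ← identify-all n (s ∘ (false ∷_)) (t ∘ (false ∷_)) (eq ∘ (false ∷_))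
    -- The second half is solved after renaming by `f`; its equations under `g` survive because g ∘
    -- f ≗ g.
    with h , gh≗g , hs≡ht ← identify-all n (map f ∘ s ∘ (true ∷_)) (map f ∘ t ∘ (true ∷_))
           (λ c → trans (sym (map-∘ (s (true ∷ c))))
                 (trans (map-cong gf≗g (s (true ∷ c)))
                 (trans (eq (true ∷ c))
                 (trans (sym (map-cong gf≗g (t (true ∷ c))))
                        (map-∘ (t (true ∷ c)))))))
    = h ∘ f , (λ z → trans (gh≗g (f z)) (gf≗g z)) , identified
    where
    identified : ∀ c → map (h ∘ f) (s c) ≡ map (h ∘ f) (t c)
    identified (false ∷ c) = trans (map-∘ (s _)) (trans (cong (map h) (fs≡ft c)) (sym (map-∘ (t _))))
    identified (true  ∷ c) = trans (map-∘ (s _)) (trans (hs≡ht c) (sym (map-∘ (t _))))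

-- Mirrored vectors

-- Choices become a permutation in `𝒯`, which is matched by hypothesis and turned back into choices.
mirrored⇒reads : ∀ {S : Set a} (s s′ : Vector S (suc n)) →
                 (∀ σ → 𝒯 σ → ∃[ σ′ ] 𝒯 σ′ × σ · s ≗ σ′ · s′) →
                 ∀ c → ∃[ c′ ] read c s ≡ read c′ s′
mirrored⇒reads {S = S} s s′ H c
  with σ  , V  , σs≡  ← read⇒VShaped S c
  with σ′ , T′ , eq   ← H σ (VShaped⇒𝒯 σ V)
  with c′ , σ′s′≡     ← VShaped⇒read S σ′ (𝒯⇒VShaped σ′ T′) =
  c′ , trans (sym (σs≡ s)) (trans (descending-cong eq) (σ′s′≡ s′))

reads⇒≗-or-rev : ∀ {S : Set a} (s s′ : Vector S n) →
                 (∀ c → ∃[ c′ ] read c s ≡ read c′ s′) →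
                 (∀ c → ∃[ c′ ] read c s′ ≡ read c′ s) →
                 s ≗ s′ ⊎ s ≗ rev s′
reads⇒≗-or-rev {n = n} {S = S} s s′ H H′ = conclude
  (sameReadings⇒∼ _≟_ _ ℕ.≤-refl (readings⊆ (proj₁ ∘ H) (identified ∘ (false ∷_)))
                                  (readings⊆ (proj₁ ∘ H′) (identified ∘ (true ∷_))))
  where
  Pos = Fin n ⊎ Fin n

  _≟_ : DecidableEquality Pos
  _≟_ = Sum.≡-dec Fin._≟_ Fin._≟_

  g : Pos → S
  g = [ s , s′ ]′

  -- The extra leading boolean selects the direction, `H` or `H′`, so that one `f` serves both.
  lhs rhs : Vec Bool (suc n) → List Pos
  lhs (false ∷ c) = read c inj₁
  lhs (true  ∷ c) = read c inj₂
  rhs (false ∷ c) = read (proj₁ (H c)) inj₂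
  rhs (true  ∷ c) = read (proj₁ (H′ c)) inj₁

  lhs≡rhs : ∀ c → map g (lhs c) ≡ map g (rhs c)
  lhs≡rhs (false ∷ c) = trans (map-read g c inj₁) (trans (proj₂ (H c)) (sym (map-read g _ inj₂)))
  lhs≡rhs (true  ∷ c) = trans (map-read g c inj₂) (trans (proj₂ (H′ c)) (sym (map-read g _ inj₁)))

  identification : ∃[ f ] g ∘ f ≗ g × (∀ c → map f (lhs c) ≡ map f (rhs c))
  identification = identify-all _≟_ g (suc n) lhs rhs lhs≡rhs

  f          = proj₁ identification
  gf≗g       = proj₁ (proj₂ identification)
  identified = proj₂ (proj₂ identification)

  p p′ : Vector Pos n
  p  = f ∘ inj₁
  p′ = f ∘ inj₂

  readings⊆ : ∀ {q q′ : Vector Pos n} (c′ : Vec Bool n → Vec Bool n) →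
              (∀ c → map f (read c q) ≡ map f (read (c′ c) q′)) → toList (f ∘ q) ≼ toList (f ∘ q′)
  readings⊆ {q} {q′} c′ eq r with c , refl ← Reads⇒read (f ∘ q) refl r =
    subst (Reads _) (trans (sym (map-read f (c′ c) q′)) (trans (sym (eq c)) (map-read f c q))) (read⇒Reads (c′ c) (f ∘ q′))

  conclude : toList p ∼ toList p′ → s ≗ s′ ⊎ s ≗ rev s′
  conclude (inj₁ eq) = inj₁ λ i → begin
    s i               ≡⟨ gf≗g (inj₁ i) ⟨
    g (p i)           ≡⟨ cong g (toList-injective eq i) ⟩
    g (p′ i)          ≡⟨ gf≗g (inj₂ i) ⟩
    s′ i              ∎
    where open ≡-Reasoning
  conclude (inj₂ eq) = inj₂ λ i → begin
    s i               ≡⟨ gf≗g (inj₁ i) ⟨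
    g (p i)           ≡⟨ cong g (toList-injective (trans eq (sym (toList-rev p′))) i) ⟩
    g (rev p′ i)      ≡⟨ gf≗g (inj₂ (opposite i)) ⟩
    rev s′ i          ∎
    where open ≡-Reasoning

-- Acting on rev s′ by σ is acting on s′ by σ after reversal, and this composite stays in `𝒯`.
≗-rev⇒matched : ∀ {S : Set a} (s s′ : Vector S (suc n)) → s ≗ rev s′ →
                ∀ σ → 𝒯 σ → ∃[ σ′ ] 𝒯 σ′ × σ · s ≗ σ′ · s′
≗-rev⇒matched s s′ eq σ T =
  reverseₚ ∘ₚ σ , VShaped⇒𝒯 (reverseₚ ∘ₚ σ) (VShaped-reverse σ (𝒯⇒VShaped σ T)) , eq ∘ (σ ⟨$⟩ˡ_)

mainTheorem9 : ∀ {a : Level} (S : Set a) (m : ℕ) → m ≥ 1 → (s s′ : Vector S m) →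
    Mirrored s s′ ⇔ (s ≗ s′ ⊎ s ≗ rev s′)
mainTheorem9 S (suc n) _ s s′ = mk⇔
  (λ { (H , H′) → reads⇒≗-or-rev s s′ (mirrored⇒reads s s′ H) (mirrored⇒reads s′ s H′) })
  λ { (inj₁ eq) → (λ σ T → σ , T , eq ∘ (σ ⟨$⟩ˡ_)) , (λ σ T → σ , T , sym ∘ eq ∘ (σ ⟨$⟩ˡ_))
    -- Reversal is an involution, so also s′ ≗ rev s.
    ; (inj₂ eq) → ≗-rev⇒matched s s′ eq , ≗-rev⇒matched s′ s λ i →
        trans (cong s′ (sym (Fin.opposite-involutive i))) (sym (eq (opposite i))) }
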